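{- Let $B$ be a Boolean algebra, let $U,V,W\subset B^n$ be Boolean domains over $B$ with $U\cup V\subset W$, and let $F:U\to V$ be a Boolean isomorphism. Then there is a Boolean isomorphism $F':W\to W$ whose restriction to $U$ is $F$.
   Context: $B$ is a fixed Boolean algebra, with operations $\vee,\wedge$, complement, and symmetric difference $a\triangle b=(a\setminus b)\vee(b\setminus a)$. A Boolean function $f:B^n\to B$ is a function given by a polynomial expression built from the variables, elements of $B$, and the Boolean operations $\vee,\wedge$ and complement (e.g. $f(x_1,x_2)=(x_1\vee x_2)\triangle a$ with $a\in B$ fixed). A Boolean domain is a set $V=\{x\in B^n: f(x)=0\}$ for some Boolean function $f:B^n\to B$. If $U\subset B^n$ and $V\subset B^m$ are Boolean domains, a map $F:U\to V$ is a Boolean transformation if there are Boolean functions $F_1,\dots,F_m:B^n\to B$ with $F(x)=(F_1(x),\dots,F_m(x))$ for all $x\in U$. A Boolean isomorphism is a bijective Boolean transformation. -}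

module Defs where

open import Algebra.Lattice.Bundles using (BooleanAlgebra)
open import Data.Fin.Base using (Fin)
open import Data.Nat.Base using (ℕ)
open import Data.Product.Base using (Σ; ∃; ∃-syntax; _×_; proj₁)
open import Data.Vec.Functional using (Vector)
open import Function.Bundles using (Func)
open import Function.Definitions using (Bijective)
open import Level using (_⊔_)
open import Relation.Binary.Bundles using (Setoid)
open import Relation.Unary using (Pred; _≐_)
import Data.Vec.Functional.Relation.Binary.Equality.Setoid as VecEquality
import Relation.Binary.Construct.On as On

module BooleanDomains {c ℓ} (B : BooleanAlgebra c ℓ) where

  open BooleanAlgebra B
  open VecEquality setoid public using (_≋_; ≋-setoid)

  infix  8 ¬ᵖ_
  infixr 7 _∧ᵖ_
  infixr 6 _∨ᵖ_

  data Polynomial (n : ℕ) : Set c where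
    var   : Fin n → Polynomial n
    const : Carrier → Polynomial n
    _∨ᵖ_  : Polynomial n → Polynomial n → Polynomial n
    _∧ᵖ_  : Polynomial n → Polynomial n → Polynomial n
    ¬ᵖ_   : Polynomial n → Polynomial n

  ⟦_⟧ : ∀ {n} → Polynomial n → Vector Carrier n → Carrier
  ⟦ var i ⟧   x = x i
  ⟦ const a ⟧ x = a
  ⟦ p ∨ᵖ q ⟧  x = ⟦ p ⟧ x ∨ ⟦ q ⟧ x
  ⟦ p ∧ᵖ q ⟧  x = ⟦ p ⟧ x ∧ ⟦ q ⟧ x
  ⟦ ¬ᵖ p ⟧    x = ¬ ⟦ p ⟧ x

  IsBooleanFunction : ∀ {n} → (Vector Carrier n → Carrier) → Set (c ⊔ ℓ)
  IsBooleanFunction {n} f = ∃[ p ] (∀ x → f x ≈ ⟦_⟧ {n} p x)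

  IsBooleanDomain : ∀ {n v} → Pred (Vector Carrier n) v → Set (c ⊔ ℓ ⊔ v)
  IsBooleanDomain V = ∃[ f ] IsBooleanFunction f × V ≐ (λ x → f x ≈ ⊥)

  -- Points are compared by their coordinates only, so the proof of membership
  -- that a point carries is irrelevant to maps between such setoids.
  Points : ∀ {n v} → Pred (Vector Carrier n) v → Setoid (c ⊔ v) ℓ
  Points {n} V = On.setoid {B = ∃ V} (≋-setoid n) proj₁

  module _ {n m u v} {U : Pred (Vector Carrier n) u} {V : Pred (Vector Carrier m) v} where

    IsBooleanTransformation : Func (Points U) (Points V) → Set (c ⊔ ℓ ⊔ u)
    IsBooleanTransformation F =
      Σ (Fin m → Vector Carrier n → Carrier) λ Fs →
        (∀ i → IsBooleanFunction (Fs i)) ×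
        (∀ x → proj₁ (Func.to F x) ≋ (λ i → Fs i (proj₁ x)))

    IsBooleanIsomorphism : Func (Points U) (Points V) → Set (c ⊔ ℓ ⊔ u ⊔ v)
    IsBooleanIsomorphism F =
      IsBooleanTransformation F ×
      Bijective (Setoid._≈_ (Points U)) (Setoid._≈_ (Points V)) (Func.to F)

{-# OPTIONS --safe #-}
-- For c ∈ B, write x ≈[ c ] y for c ∧ x ≈ c ∧ y, that is, equality on the part
-- of the Stone space given by c.  Boolean functions respect ≈[ c ], and an
-- equation may be checked on c ∧ a and on c ∧ ¬ a separately.  This replaces
-- stalkwise reasoning, so B may be infinite and without decidable equality.
--
-- F' is a composite of transpositions of points of Bⁿ.  For each corner e of
-- the cube {⊤,⊥}ⁿ in turn, the current image T e of e is exchanged with F e on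
-- the part of B where e lies in U and where e and F e agree about W; on the
-- other part nothing is done.  Each exchange is an involution that preserves
-- W, so the composite is a bijection of W even when U is empty.  When U has a
-- point, points given on parts of B can be glued with it to global points of U,
-- so F is locally injective and later exchanges do not spoil the values
-- already arranged.
module Submission where

open import Defs
open import Algebra.Lattice.Bundles using (BooleanAlgebra)
import Algebra.Lattice.Properties.BooleanAlgebra as BooleanAlgebraProperties
open import Data.Fin.Base using (Fin; zero; suc)
open import Data.List.Base using (List; []; _∷_; _++_; map)
open import Data.List.Relation.Unary.All as All using (All; []; _∷_)
open import Data.List.Relation.Unary.All.Properties using (map⁻; ++⁻ˡ; ++⁻ʳ)
open import Data.Nat.Base using (ℕ; zero; suc)
open import Data.Product.Base using (Σ; ∃; _×_; _,_; proj₁; proj₂)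
open import Data.Sum.Base using (inj₁; inj₂)
open import Data.Vec.Functional as Vector using (Vector; head; tail)
open import Function.Base using (_∘_)
open import Function.Bundles using (Func)
open import Function.Definitions using (Injective; Surjective)
open import Level using (_⊔_)
open import Relation.Unary using (Pred; _∈_; _⊆_; _∪_)
open import Relation.Binary.Bundles using (Setoid)
import Relation.Binary.Reasoning.Setoid as SetoidReasoning

module Localisation {c ℓ} (B : BooleanAlgebra c ℓ) where

  open BooleanAlgebra B
  open BooleanAlgebraProperties B
  open BooleanDomains B

  infix 4 _≈[_]_ _≋[_]_

  _≈[_]_ : Carrier → Carrier → Carrier → Set ℓ
  x ≈[ c ] y = c ∧ x ≈ c ∧ y

  _≋[_]_ : ∀ {n} → Vector Carrier n → Carrier → Vector Carrier n → Set ℓ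
  x ≋[ c ] y = ∀ i → x i ≈[ c ] y i

  private
    variable
      n : ℕ
      a b d x y g h : Carrier
      xs ys : Vector Carrier n

  -- Local equality

  local : x ≈ y → x ≈[ d ] y
  local = ∧-congˡ

  global : x ≈[ ⊤ ] y → x ≈ y
  global p = trans (sym (∧-identityˡ _)) (trans p (∧-identityˡ _))

  weaken : ∀ a → x ≈[ d ] y → x ≈[ d ∧ a ] y
  weaken {x} {d} {y} a p = begin
    (d ∧ a) ∧ x  ≈⟨ ∧-congʳ (∧-comm d a) ⟩
    (a ∧ d) ∧ x  ≈⟨ ∧-assoc a d x ⟩
    a ∧ d ∧ x    ≈⟨ ∧-congˡ p ⟩
    a ∧ d ∧ y    ≈⟨ ∧-assoc a d y ⟨
    (a ∧ d) ∧ y  ≈⟨ ∧-congʳ (∧-comm a d) ⟩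
    (d ∧ a) ∧ y  ∎
    where open SetoidReasoning setoid

  relocate : a ≈ b → x ≈[ a ] y → x ≈[ b ] y
  relocate a≈b p = trans (∧-congʳ (sym a≈b)) (trans p (∧-congʳ a≈b))

  weakenˡ : ∀ a → x ≈[ d ] y → x ≈[ a ∧ d ] y
  weakenˡ a p = relocate (∧-comm _ a) (weaken a p)

  -- The premise `d ≈[ a ] ⊤` encodes a ≤ d; inclusions between parts of B are expressed this way
  -- throughout.
  restrict : d ≈[ a ] ⊤ → x ≈[ d ] y → x ≈[ a ] y
  restrict {d} {a} p q =
    relocate (trans p (∧-identityʳ a)) (weakenˡ a q)

  self : a ≈[ a ] ⊤
  self {a} = trans (∧-idem a) (sym (∧-identityʳ a))

  self-¬ : a ≈[ ¬ a ] ⊥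
  self-¬ {a} = trans (∧-complementˡ a) (sym (∧-zeroʳ (¬ a)))

  split : ∀ a → x ≈[ d ∧ a ] y → x ≈[ d ∧ ¬ a ] y → x ≈[ d ] y
  split {x} {d} {y} a p q = begin
    d ∧ x                              ≈⟨ cover x ⟨
    (d ∧ a) ∧ x ∨ (d ∧ ¬ a) ∧ x        ≈⟨ ∨-cong p q ⟩
    (d ∧ a) ∧ y ∨ (d ∧ ¬ a) ∧ y        ≈⟨ cover y ⟩
    d ∧ y                              ∎
    where
    open SetoidReasoning setoid
    cover : ∀ z → (d ∧ a) ∧ z ∨ (d ∧ ¬ a) ∧ z ≈ d ∧ z
    cover z = begin
      (d ∧ a) ∧ z ∨ (d ∧ ¬ a) ∧ z  ≈⟨ ∧-distribʳ-∨ z (d ∧ a) (d ∧ ¬ a) ⟨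
      (d ∧ a ∨ d ∧ ¬ a) ∧ z        ≈⟨ ∧-congʳ (∧-distribˡ-∨ d a (¬ a)) ⟨
      (d ∧ (a ∨ ¬ a)) ∧ z          ≈⟨ ∧-congʳ (∧-congˡ (∨-complementʳ a)) ⟩
      (d ∧ ⊤) ∧ z                  ≈⟨ ∧-congʳ (∧-identityʳ d) ⟩
      d ∧ z                        ∎

  split-⊤ : ∀ a → x ≈[ a ] y → x ≈[ ¬ a ] y → x ≈ y
  split-⊤ a p q = global (split a (weakenˡ ⊤ p) (weakenˡ ⊤ q))

  local-∧ : a ≈[ d ] b → x ≈[ d ] y → a ∧ x ≈[ d ] b ∧ y
  local-∧ {a} {d} {b} {x} {y} p q = begin
    d ∧ a ∧ x          ≈⟨ distrib a x ⟩
    (d ∧ a) ∧ (d ∧ x)  ≈⟨ ∧-cong p q ⟩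
    (d ∧ b) ∧ (d ∧ y)  ≈⟨ distrib b y ⟨
    d ∧ b ∧ y          ∎
    where
    open SetoidReasoning setoid
    distrib : ∀ u v → d ∧ u ∧ v ≈ (d ∧ u) ∧ (d ∧ v)
    distrib u v = begin
      d ∧ u ∧ v          ≈⟨ ∧-congʳ (∧-idem d) ⟨
      (d ∧ d) ∧ u ∧ v    ≈⟨ ∧-assoc d d (u ∧ v) ⟩
      d ∧ d ∧ u ∧ v      ≈⟨ ∧-congˡ (∧-assoc d u v) ⟨
      d ∧ (d ∧ u) ∧ v    ≈⟨ ∧-congˡ (∧-congʳ (∧-comm d u)) ⟩
      d ∧ (u ∧ d) ∧ v    ≈⟨ ∧-congˡ (∧-assoc u d v) ⟩
      d ∧ u ∧ d ∧ v      ≈⟨ ∧-assoc d u (d ∧ v) ⟨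
      (d ∧ u) ∧ (d ∧ v)  ∎

  local-∨ : a ≈[ d ] b → x ≈[ d ] y → a ∨ x ≈[ d ] b ∨ y
  local-∨ {a} {d} {b} {x} {y} p q = begin
    d ∧ (a ∨ x)    ≈⟨ ∧-distribˡ-∨ d a x ⟩
    d ∧ a ∨ d ∧ x  ≈⟨ ∨-cong p q ⟩
    d ∧ b ∨ d ∧ y  ≈⟨ ∧-distribˡ-∨ d b y ⟨
    d ∧ (b ∨ y)    ∎
    where open SetoidReasoning setoid

  local-¬ : x ≈[ d ] y → ¬ x ≈[ d ] ¬ y
  local-¬ {x} {d} {y} p = begin
    d ∧ ¬ x        ≈⟨ absorb x ⟨
    d ∧ ¬ (d ∧ x)  ≈⟨ ∧-congˡ (¬-cong p) ⟩
    d ∧ ¬ (d ∧ y)  ≈⟨ absorb y ⟩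
    d ∧ ¬ y        ∎
    where
    open SetoidReasoning setoid
    -- De Morgan turns the inner `d` into a summand `¬ d`, which the outer `d` annihilates.
    absorb : ∀ z → d ∧ ¬ (d ∧ z) ≈ d ∧ ¬ z
    absorb z = begin
      d ∧ ¬ (d ∧ z)      ≈⟨ ∧-congˡ (deMorgan₁ d z) ⟩
      d ∧ (¬ d ∨ ¬ z)    ≈⟨ ∧-distribˡ-∨ d (¬ d) (¬ z) ⟩
      d ∧ ¬ d ∨ d ∧ ¬ z  ≈⟨ ∨-congʳ (∧-complementʳ d) ⟩
      ⊥ ∨ d ∧ ¬ z        ≈⟨ ∨-identityˡ (d ∧ ¬ z) ⟩
      d ∧ ¬ z            ∎

  -- Boolean functions

  IsBooleanMap : ∀ {n m} → (Vector Carrier n → Vector Carrier m) → Set (c ⊔ ℓ)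
  IsBooleanMap T = ∀ i → IsBooleanFunction (λ x → T x i)

  boolean-var : IsBooleanMap {n} (λ x → x)
  boolean-var i = var i , λ x → refl

  boolean-const : ∀ a → IsBooleanFunction {n} (λ _ → a)
  boolean-const a = const a , λ x → refl

  module _ {f g : Vector Carrier n → Carrier} where

    boolean-∧ : IsBooleanFunction f → IsBooleanFunction g →
                IsBooleanFunction (λ x → f x ∧ g x)
    boolean-∧ (p , f≈) (q , g≈) = p ∧ᵖ q , λ x → ∧-cong (f≈ x) (g≈ x)

    boolean-∨ : IsBooleanFunction f → IsBooleanFunction g →
                IsBooleanFunction (λ x → f x ∨ g x)
    boolean-∨ (p , f≈) (q , g≈) = p ∨ᵖ q , λ x → ∨-cong (f≈ x) (g≈ x)

  boolean-¬ : ∀ {f : Vector Carrier n → Carrier} →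
              IsBooleanFunction f → IsBooleanFunction (λ x → ¬ f x)
  boolean-¬ (p , f≈) = ¬ᵖ p , λ x → ¬-cong (f≈ x)

  polynomial-local : ∀ (p : Polynomial n) → xs ≋[ d ] ys →
                     ⟦ p ⟧ xs ≈[ d ] ⟦ p ⟧ ys
  polynomial-local (var i)   e = e i
  polynomial-local (const a) e = refl
  polynomial-local (p ∨ᵖ q)  e = local-∨ (polynomial-local p e) (polynomial-local q e)
  polynomial-local (p ∧ᵖ q)  e = local-∧ (polynomial-local p e) (polynomial-local q e)
  polynomial-local (¬ᵖ p)    e = local-¬ (polynomial-local p e)

  boolean-∘ : ∀ {m} {f : Vector Carrier m → Carrier}
              {T : Vector Carrier n → Vector Carrier m} →
              IsBooleanFunction f → IsBooleanMap T → IsBooleanFunction (f ∘ T)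
  boolean-∘ {m = m} {T = T} (p , f≈) bT =
    let q , pT≈ = substitute p in q , λ x → trans (f≈ (T x)) (pT≈ x)
    where
    substitute : (p : Polynomial m) → IsBooleanFunction (λ x → ⟦ p ⟧ (T x))
    substitute (var i)   = bT i
    substitute (const a) = boolean-const a
    substitute (p ∨ᵖ q)  = boolean-∨ (substitute p) (substitute q)
    substitute (p ∧ᵖ q)  = boolean-∧ (substitute p) (substitute q)
    substitute (¬ᵖ p)    = boolean-¬ (substitute p)

  boolean-local : ∀ {f : Vector Carrier n → Carrier} → IsBooleanFunction f →
                  xs ≋[ d ] ys → f xs ≈[ d ] f ys
  boolean-local (p , f≈) e =
    trans (local (f≈ _)) (trans (polynomial-local p e) (sym (local (f≈ _))))

  boolean-cong : ∀ {f : Vector Carrier n → Carrier} → IsBooleanFunction f →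
                 xs ≋ ys → f xs ≈ f ys
  boolean-cong f e = global (boolean-local f (λ i → local (e i)))

  -- Case distinction and equality with values in B

  mux : Carrier → Carrier → Carrier → Carrier
  mux s a b = s ∧ a ∨ ¬ s ∧ b

  muxᵥ : Carrier → Vector Carrier n → Vector Carrier n → Vector Carrier n
  muxᵥ s x y i = mux s (x i) (y i)

  local-mux : ∀ {s t} → s ≈[ d ] t → a ≈[ d ] b → x ≈[ d ] y →
              mux s a x ≈[ d ] mux t b y
  local-mux p q r = local-∨ (local-∧ p q) (local-∧ (local-¬ p) r)

  boolean-mux : ∀ {f g h : Vector Carrier n → Carrier} →
                IsBooleanFunction f → IsBooleanFunction g → IsBooleanFunction h →
                IsBooleanFunction (λ x → mux (f x) (g x) (h x))
  boolean-mux f g h = boolean-∨ (boolean-∧ f g) (boolean-∧ (boolean-¬ f) h)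

  mux-⊤ : ∀ a b → mux ⊤ a b ≈ a
  mux-⊤ a b = begin
    ⊤ ∧ a ∨ ¬ ⊤ ∧ b  ≈⟨ ∨-cong (∧-identityˡ a) (∧-congʳ ¬⊤≈⊥) ⟩
    a ∨ ⊥ ∧ b        ≈⟨ ∨-congˡ (∧-zeroˡ b) ⟩
    a ∨ ⊥            ≈⟨ ∨-identityʳ a ⟩
    a                ∎
    where open SetoidReasoning setoid

  mux-⊥ : ∀ a b → mux ⊥ a b ≈ b
  mux-⊥ a b = begin
    ⊥ ∧ a ∨ ¬ ⊥ ∧ b  ≈⟨ ∨-cong (∧-zeroˡ a) (∧-congʳ ¬⊥≈⊤) ⟩
    ⊥ ∨ ⊤ ∧ b        ≈⟨ ∨-identityˡ _ ⟩
    ⊤ ∧ b            ≈⟨ ∧-identityˡ b ⟩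
    b                ∎
    where open SetoidReasoning setoid

  mux-true : ∀ {s} → s ≈[ d ] ⊤ → mux s a b ≈[ d ] a
  mux-true p = trans (local-mux p refl refl) (local (mux-⊤ _ _))

  mux-false : ∀ {s} → s ≈[ d ] ⊥ → mux s a b ≈[ d ] b
  mux-false p = trans (local-mux p refl refl) (local (mux-⊥ _ _))

  -- The complement of the symmetric difference: the largest part of B on which `x` and `y` agree.
  iff : Carrier → Carrier → Carrier
  iff x y = mux x y (¬ y)

  local-iff : a ≈[ d ] b → x ≈[ d ] y → iff a x ≈[ d ] iff b y
  local-iff p q = local-mux p q (local-¬ q)

  iff-refl : ∀ x → iff x x ≈ ⊤
  iff-refl x = split-⊤ x
    (trans (mux-true self) self)
    (trans (mux-false self-¬) (trans (local-¬ self-¬) (local ¬⊥≈⊤)))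

  iff-⊤ : ∀ x → iff x ⊤ ≈ x
  iff-⊤ x = split-⊤ x
    (trans (mux-true self) (sym self))
    (trans (mux-false self-¬) (trans (local ¬⊤≈⊥) (sym self-¬)))

  iff-⊥ : ∀ x → iff x ⊥ ≈ ¬ x
  iff-⊥ x = split-⊤ x
    (trans (mux-true self) (sym (trans (local-¬ self) (local ¬⊤≈⊥))))
    (trans (mux-false self-¬) (sym (local-¬ self-¬)))

  iff-sound : ∀ x y → x ≈[ iff x y ] y
  iff-sound x y = split x
    (trans (weakenˡ _ self)
      (trans (sym (weaken x self)) (mux-true (weakenˡ _ self))))
    -- Where `x` is false, `iff x y` reduces to `¬ y`; since `iff x y` is true on itself, `y` is
    -- false there too.
    (trans (weakenˡ _ self-¬)
      (trans (local (sym ¬⊤≈⊥))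
        (trans (local-¬ (trans (sym (weaken (¬ x) self)) (mux-false (weakenˡ _ self-¬))))
          (local (¬-involutive y)))))

  -- Equality of points with truth values in B. By `eq-sound` and `eq-complete` its value is the
  -- largest part on which all coordinates agree.
  eq : Vector Carrier n → Vector Carrier n → Carrier
  eq {zero}  x y = ⊤
  eq {suc n} x y = iff (head x) (head y) ∧ eq (tail x) (tail y)

  boolean-eq : ∀ {m} {T S : Vector Carrier n → Vector Carrier m} →
               IsBooleanMap T → IsBooleanMap S →
               IsBooleanFunction (λ x → eq (T x) (S x))
  boolean-eq {m = zero}  T S = boolean-const ⊤
  boolean-eq {m = suc m} T S =
    boolean-∧ (boolean-mux (T zero) (S zero) (boolean-¬ (S zero)))
              (boolean-eq (T ∘ suc) (S ∘ suc))

  eq-refl : ∀ (x : Vector Carrier n) → eq x x ≈ ⊤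
  eq-refl {zero}  x = refl
  eq-refl {suc n} x =
    trans (∧-cong (iff-refl (head x)) (eq-refl (tail x))) (∧-identityˡ ⊤)

  eq-sound : ∀ (x y : Vector Carrier n) → x ≋[ eq x y ] y
  eq-sound x y zero    = weaken _ (iff-sound (head x) (head y))
  eq-sound x y (suc i) = weakenˡ _ (eq-sound (tail x) (tail y) i)

  -- As a Boolean function of its first argument, `eq` cannot distinguish `x` from `y` on `d`, so
  -- reflexivity at `y` suffices.
  eq-complete : ∀ {x y : Vector Carrier n} → x ≋[ d ] y → eq x y ≈[ d ] ⊤
  eq-complete {y = y} x≋y =
    trans (boolean-local (boolean-eq boolean-var (λ i → boolean-const (y i))) x≋y)
          (local (eq-refl y))

  -- The corners of the cube and the cover of B that they induce at a point

  corners : ∀ n → List (Vector Carrier n)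
  corners zero    = (λ ()) ∷ []
  corners (suc n) = map (⊤ Vector.∷_) (corners n) ++ map (⊥ Vector.∷_) (corners n)

  -- The elements `eq x e` are the minterms in the coordinates of `x`, and their join is `⊤`. The
  -- induction splits on the first coordinate, whose factor `iff-⊤` and `iff-⊥` simplify to `head x`
  -- or its complement.
  corners-cover : ∀ (x : Vector Carrier n) →
                  All (λ e → g ≈[ d ∧ eq x e ] h) (corners n) → g ≈[ d ] h
  corners-cover {zero}  x (p ∷ []) = relocate (∧-identityʳ _) p
  corners-cover {suc n} x ps = split (head x)
    (corners-cover (tail x) (All.map
      (relocate (trans (∧-congˡ (∧-congʳ (iff-⊤ (head x)))) (sym (∧-assoc _ _ _))))
      (map⁻ (++⁻ˡ _ ps))))
    (corners-cover (tail x) (All.map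
      (relocate (trans (∧-congˡ (∧-congʳ (iff-⊥ (head x)))) (sym (∧-assoc _ _ _))))
      (map⁻ (++⁻ʳ (map (⊤ Vector.∷_) (corners n)) ps))))

  -- Transpositions

  swap : (a b x : Vector Carrier n) → Vector Carrier n
  swap a b x = muxᵥ (eq x a) b (muxᵥ (eq x b) a x)

  module _ (a b : Vector Carrier n) where

    boolean-swap : ∀ {m} {T : Vector Carrier m → Vector Carrier n} →
                   IsBooleanMap T → IsBooleanMap (swap a b ∘ T)
    boolean-swap T i =
      boolean-mux (boolean-eq T (boolean-const ∘ a)) (boolean-const (b i))
        (boolean-mux (boolean-eq T (boolean-const ∘ b)) (boolean-const (a i)) (T i))

    swap-local : xs ≋[ d ] ys → swap a b xs ≋[ d ] swap a b ys
    swap-local e i = boolean-local (boolean-swap boolean-var i) e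

    swap-first : xs ≋[ d ] a → swap a b xs ≋[ d ] b
    swap-first p i = mux-true (eq-complete p)

    swap-other : eq xs a ≈[ d ] ⊥ → eq xs b ≈[ d ] ⊥ → swap a b xs ≋[ d ] xs
    swap-other p q i = trans (mux-false p) (mux-false q)

    -- The test against `a` takes precedence in `swap`. Where it succeeds as well, `a` and `b` both
    -- equal `xs`, so the result `b` is also `a`.
    swap-second : xs ≋[ d ] b → swap a b xs ≋[ d ] a
    swap-second {xs} {d} p i = split (eq xs a)
      (trans (swap-first xs≋a i)
        (trans (sym (weaken _ (p i))) (xs≋a i)))
      (trans (mux-false (weakenˡ _ self-¬)) (mux-true (weaken _ (eq-complete p))))
      where
      xs≋a : xs ≋[ d ∧ eq xs a ] a
      xs≋a j = weakenˡ d (eq-sound xs a j)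

    -- The three cases live on the parts cut out by `eq x a` and `eq x b`. Stating each for an
    -- arbitrary `k` hides these parts, so that only the resulting local equation is used.
    swap-cases : ∀ x →
      (∀ {k} → x ≋[ d ∧ k ] a → g ≈[ d ∧ k ] h) →
      (∀ {k} → x ≋[ d ∧ k ] b → g ≈[ d ∧ k ] h) →
      (∀ {k} → swap a b x ≋[ d ∧ k ] x → g ≈[ d ∧ k ] h) →
      g ≈[ d ] h
    swap-cases {d} x p q r = split (eq x a)
      (p (λ i → weakenˡ d (eq-sound x a i)))
      (split (eq x b)
        (relocate (sym (∧-assoc _ _ _))
          (q (λ i → weakenˡ d (weakenˡ _ (eq-sound x b i)))))
        (relocate (sym (∧-assoc _ _ _))
          (r (swap-other (weakenˡ d (weaken _ self-¬)) (weakenˡ d (weakenˡ _ self-¬))))))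

    swap-involutive : ∀ x → swap a b (swap a b x) ≋ x
    swap-involutive x i = global (swap-cases x
      (λ p → trans (swap-second (swap-first p) i) (sym (p i)))
      (λ p → trans (swap-first (swap-second p) i) (sym (p i)))
      (λ p → trans (swap-local p i) (p i)))

    swap-injective : swap a b xs ≋[ d ] swap a b ys → xs ≋[ d ] ys
    swap-injective {xs} {ys = ys} e i =
      trans (sym (local (swap-involutive xs i)))
        (trans (swap-local e i) (local (swap-involutive ys i)))

    swap-invariant : ∀ {f} → IsBooleanFunction f → f a ≈ f b →
                     ∀ x → f (swap a b x) ≈ f x
    swap-invariant f fa≈fb x = global (swap-cases x
      (λ p → trans (boolean-local f (swap-first p))
        (trans (local (sym fa≈fb)) (sym (boolean-local f p))))
      (λ p → trans (boolean-local f (swap-second p))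
        (trans (local fa≈fb) (sym (boolean-local f p))))
      (boolean-local f))

  -- Extension of a partial map by successive transpositions

  -- s x is the part of B on which x lies in the domain of Φ.

  module Extension (Φ : Vector Carrier n → Vector Carrier n)
                   (s : Vector Carrier n → Carrier) where

    extend : List (Vector Carrier n) → Vector Carrier n → Vector Carrier n

    -- Off `s e` this is `extend L e` itself, so that there the transposition exchanges a point with
    -- itself.
    target : Vector Carrier n → List (Vector Carrier n) → Vector Carrier n
    target e L = muxᵥ (s e) (Φ e) (extend L e)

    extend []      x = x
    extend (e ∷ L) x = swap (extend L e) (target e L) (extend L x)

    boolean-extend : ∀ L → IsBooleanMap (extend L)
    boolean-extend []      = boolean-var
    boolean-extend (e ∷ L) = boolean-swap (extend L e) (target e L) (boolean-extend L)

    extend-injective : ∀ L → extend L xs ≋[ d ] extend L ys → xs ≋[ d ] ys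
    extend-injective []      p = p
    extend-injective (e ∷ L) p =
      extend-injective L (swap-injective (extend L e) (target e L) p)

    extend-surjective : ∀ L y → ∃ λ x → extend L x ≋ y
    extend-surjective []      y = y , λ i → refl
    extend-surjective (e ∷ L) y =
      let x , p = extend-surjective L (swap (extend L e) (target e L) y)
      in x , λ i →
        trans (boolean-cong (boolean-swap (extend L e) (target e L) boolean-var i) p)
              (swap-involutive (extend L e) (target e L) y i)

    -- Every transposition exchanges two points with the same value of `f`. Taking for `f` the
    -- equation of a domain shows that the domain is preserved.
    extend-invariant : ∀ {f} → IsBooleanFunction f → (∀ x → f x ≈[ s x ] f (Φ x)) →
                       ∀ L x → f (extend L x) ≈ f x
    extend-invariant {f} bf fΦ []      x = refl
    extend-invariant {f} bf fΦ (e ∷ L) x =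
      trans (swap-invariant (extend L e) (target e L) bf balanced (extend L x))
            (extend-invariant bf fΦ L x)
      where
      -- On `s e` both sides equal `f e`, by the induction hypothesis and by `fΦ`; off `s e` the two
      -- points coincide.
      balanced : f (extend L e) ≈ f (target e L)
      balanced = split-⊤ (s e)
        (trans (local (extend-invariant bf fΦ L e))
          (trans (fΦ e) (sym (boolean-local bf (λ i → mux-true self)))))
        (sym (boolean-local bf (λ i → mux-false self-¬)))

    -- Agreement of the composite with `Φ`

    module _ (boolean-Φ : IsBooleanMap Φ) (boolean-s : IsBooleanFunction s)
             (Φ-injective : ∀ {d x y} → s x ≈[ d ] ⊤ → s y ≈[ d ] ⊤ →
                            Φ x ≋[ d ] Φ y → x ≋[ d ] y) where

      extend-local : ∀ L → xs ≋[ d ] ys → extend L xs ≋[ d ] extend L ys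
      extend-local L p i = boolean-local (boolean-extend L i) p

      extend-step : ∀ L e {e′} → extend L e′ ≋[ s e′ ] Φ e′ →
                    extend (e ∷ L) e′ ≋[ s e′ ] Φ e′
      extend-step L e {e′} ih i = swap-cases from to (extend L e′) first second other
        where
        from = extend L e
        to = target e L

        -- Injectivity of `extend L` forces `e` and `e′` to agree here, so the new value `Φ e` is
        -- the desired one.
        first : ∀ {k} → extend L e′ ≋[ s e′ ∧ k ] from →
                extend (e ∷ L) e′ i ≈[ s e′ ∧ k ] Φ e′ i
        first p =
          let e≋e′ = λ j → sym (extend-injective L p j)
          in trans (swap-first from to p i)
               (trans (mux-true (trans (boolean-local boolean-s e≋e′) (weaken _ self)))
                 (boolean-local (boolean-Φ i) e≋e′))

        -- The new value is `extend L e`. On `s e`, local injectivity of `Φ` identifies `e` with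
        -- `e′`; off `s e`, `target` is `extend L e`, so nothing has moved.
        second : ∀ {k} → extend L e′ ≋[ s e′ ∧ k ] to →
                 extend (e ∷ L) e′ i ≈[ s e′ ∧ k ] Φ e′ i
        second {k} p = trans (swap-second from to p i) (split (s e)
          (trans (extend-local L e≋e′ i) (weaken _ (weaken _ (ih i))))
          (trans (sym (mux-false (weakenˡ _ self-¬)))
            (trans (sym (weaken _ (p i))) (weaken _ (weaken _ (ih i))))))
          where
          e≋e′ : e ≋[ (s e′ ∧ k) ∧ s e ] e′
          e≋e′ = Φ-injective (weakenˡ _ self) (weaken _ (weaken _ self)) λ j →
            trans (sym (mux-true (weakenˡ _ self)))
              (trans (sym (weaken _ (p j))) (weaken _ (weaken _ (ih j))))

        other : ∀ {k} → extend (e ∷ L) e′ ≋[ s e′ ∧ k ] extend L e′ →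
                extend (e ∷ L) e′ i ≈[ s e′ ∧ k ] Φ e′ i
        other p = trans (p i) (weaken _ (ih i))

      extend-agrees : ∀ L → All (λ e → extend L e ≋[ s e ] Φ e) L
      extend-agrees []      = []
      extend-agrees (e ∷ L) =
        (λ i → trans (swap-first (extend L e) (target e L) (λ _ → refl) i) (mux-true self))
        ∷ All.map (extend-step L e) (extend-agrees L)

      -- On the part `eq x e` the point `x` is the corner `e`, and Boolean maps that agree at `e`
      -- there agree at `x`. Since `x` lies in the domain everywhere, that part is contained in
      -- `s e`.
      extend-corners : ∀ {x} → s x ≈ ⊤ → extend (corners n) x ≋ Φ x
      extend-corners {x} sx i = global (corners-cover x (All.map near (extend-agrees L)))
        where
        L = corners n
        near : ∀ {e} → extend L e ≋[ s e ] Φ e →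
               extend L x i ≈[ ⊤ ∧ eq x e ] Φ x i
        near {e} p = trans (extend-local L x≋e i)
          (trans (restrict se (p i)) (sym (boolean-local (boolean-Φ i) x≋e)))
          where
          x≋e : x ≋[ ⊤ ∧ eq x e ] e
          x≋e j = weakenˡ ⊤ (eq-sound x e j)
          se : s e ≈[ ⊤ ∧ eq x e ] ⊤
          se = trans (sym (boolean-local boolean-s x≋e)) (local sx)

theorem1 : ∀ {c ℓ u v w} (B : BooleanAlgebra c ℓ) →
    let open BooleanAlgebra B using (Carrier)
        open BooleanDomains B
    in
    (n : ℕ)
    (U : Pred (Vector Carrier n) u)
    (V : Pred (Vector Carrier n) v)
    (W : Pred (Vector Carrier n) w) →
    IsBooleanDomain U → IsBooleanDomain V → IsBooleanDomain W →
    U ∪ V ⊆ W →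
    (F : Func (Points U) (Points V)) → IsBooleanIsomorphism F →
    Σ (Func (Points W) (Points W)) λ F' →
      IsBooleanIsomorphism F' ×
      (∀ x (x∈U : x ∈ U) (x∈W : x ∈ W) →
        proj₁ (Func.to F' (x , x∈W)) ≋ proj₁ (Func.to F (x , x∈U)))
theorem1 B n U V W (f , boolean-f , U⊆f , f⊆U) _ (h , boolean-h , W⊆h , h⊆W) U∪V⊆W
  F ((Φs , boolean-Φ , F≋Φ) , F-injective , _) =
  F′ ,
  ((T , boolean-extend L , λ _ _ → refl) ,
   (λ {x} {y} → F′-injective {x} {y}) , F′-surjective) ,
  agrees
  where
  open BooleanAlgebra B
  open BooleanAlgebraProperties B
  open BooleanDomains B
  open Localisation B

  Φ : Vector Carrier n → Vector Carrier n
  Φ x i = Φs i x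

  -- The first factor is the part where `x` satisfies the equation of `U`. The second makes `Φ`
  -- respect `h` on `s x` by construction, whatever `Φ` does outside `U`.
  s : Vector Carrier n → Carrier
  s x = ¬ f x ∧ iff (h x) (h (Φ x))

  open Extension Φ s

  L = corners n

  T : Fin n → Vector Carrier n → Carrier
  T i x = extend L x i

  boolean-s : IsBooleanFunction s
  boolean-s =
    let hΦ = boolean-∘ boolean-h boolean-Φ
    in boolean-∧ (boolean-¬ boolean-f) (boolean-mux boolean-h hΦ (boolean-¬ hΦ))

  h-invariant : ∀ x → h (extend L x) ≈ h x
  h-invariant = extend-invariant boolean-h (λ x → weakenˡ _ (iff-sound _ _)) L

  F′ : Func (Points W) (Points W)
  F′ = record
    { to   = λ (x , x∈W) → extend L x , h⊆W (trans (h-invariant x) (W⊆h x∈W))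
    ; cong = λ x≋y i → boolean-cong (boolean-extend L i) x≋y
    }

  F′-injective : Injective (Setoid._≈_ (Points W)) (Setoid._≈_ (Points W)) (Func.to F′)
  F′-injective Tx≋Ty i = global (extend-injective L (λ j → local (Tx≋Ty j)) i)

  F′-surjective : Surjective (Setoid._≈_ (Points W)) (Setoid._≈_ (Points W)) (Func.to F′)
  F′-surjective (y , y∈W) =
    let x , Tx≋y = extend-surjective L y
    in (x , h⊆W (trans (sym (h-invariant x)) (trans (boolean-cong boolean-h Tx≋y) (W⊆h y∈W)))) ,
       λ z≋x i → trans (boolean-cong (boolean-extend L i) z≋x) (Tx≋y i)

  -- Local injectivity of `Φ`, given a point of `U`

  module _ (x₀ : Vector Carrier n) (x₀∈U : x₀ ∈ U) where

    glue : Carrier → Vector Carrier n → Vector Carrier n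
    glue d x = muxᵥ d x x₀

    glue-∈ : ∀ {d x} → f x ≈[ d ] ⊥ → glue d x ∈ U
    glue-∈ {d} {x} fx = f⊆U (split-⊤ d
      (trans (boolean-local boolean-f (λ i → mux-true (self))) fx)
      (trans (boolean-local boolean-f (λ i → mux-false (self-¬)))
             (local (U⊆f x₀∈U))))

    -- Injectivity of `F` concerns only global points of `U`, so `x` and `y` are both completed by
    -- `x₀` outside `d`.
    Φ-injective : ∀ {d x y} → s x ≈[ d ] ⊤ → s y ≈[ d ] ⊤ →
                  Φ x ≋[ d ] Φ y → x ≋[ d ] y
    Φ-injective {d} {x} {y} sx sy Φx≋Φy i =
      trans (sym (mux-true (self))) (trans (local (glued≋ i)) (mux-true (self)))
      where
      f≈⊥ : ∀ z → s z ≈[ d ] ⊤ → f z ≈[ d ] ⊥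
      f≈⊥ z sz = begin
        d ∧ f z                          ≈⟨ local (∧-identityʳ (f z)) ⟨
        d ∧ f z ∧ ⊤                      ≈⟨ local-∧ refl sz ⟨
        d ∧ f z ∧ ¬ f z ∧ t              ≈⟨ local (∧-assoc _ _ _) ⟨
        d ∧ (f z ∧ ¬ f z) ∧ t            ≈⟨ local (∧-congʳ (∧-complementʳ (f z))) ⟩
        d ∧ ⊥ ∧ t                        ≈⟨ local (∧-zeroˡ _) ⟩
        d ∧ ⊥                            ∎
        where
        open SetoidReasoning setoid
        t = iff (h z) (h (Φ z))

      x∈ = glue-∈ (f≈⊥ x sx)
      y∈ = glue-∈ (f≈⊥ y sy)

      -- On `d` this is the assumption on `Φ x` and `Φ y`; on `¬ d` both glued points are `x₀`.
      Φ-glued : ∀ j → Φ (glue d x) j ≈ Φ (glue d y) j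
      Φ-glued j = split-⊤ d
        (trans (boolean-local (boolean-Φ j) (λ k → mux-true (self)))
          (trans (Φx≋Φy j)
            (sym (boolean-local (boolean-Φ j) (λ k → mux-true (self))))))
        (trans (boolean-local (boolean-Φ j) (λ k → mux-false (self-¬)))
          (sym (boolean-local (boolean-Φ j) (λ k → mux-false (self-¬)))))

      glued≋ : glue d x ≋ glue d y
      glued≋ = F-injective {_ , x∈} {_ , y∈} λ j →
        trans (F≋Φ (_ , x∈) j) (trans (Φ-glued j) (sym (F≋Φ (_ , y∈) j)))

    -- Both `x₀` and its image lie in `W`, so `h` vanishes at both and the second factor of `s` is
    -- `⊤`.
    s≈⊤ : s x₀ ≈ ⊤
    s≈⊤ = begin
      ¬ f x₀ ∧ iff (h x₀) (h (Φ x₀))  ≈⟨ ∧-cong (¬-cong (U⊆f x₀∈U)) hx₀↔hΦx₀ ⟩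
      ¬ ⊥ ∧ ⊤                           ≈⟨ ∧-identityʳ (¬ ⊥) ⟩
      ¬ ⊥                               ≈⟨ ¬⊥≈⊤ ⟩
      ⊤                                 ∎
      where
      open SetoidReasoning setoid
      y = Func.to F (x₀ , x₀∈U)
      hΦx₀ : h (Φ x₀) ≈ ⊥
      hΦx₀ = trans (sym (boolean-cong boolean-h (F≋Φ (x₀ , x₀∈U))))
                   (W⊆h (U∪V⊆W (inj₂ (proj₂ y))))
      hx₀↔hΦx₀ : iff (h x₀) (h (Φ x₀)) ≈ ⊤
      hx₀↔hΦx₀ = global (trans
        (local-iff (local (W⊆h (U∪V⊆W (inj₁ x₀∈U)))) (local hΦx₀))
        (local (iff-refl ⊥)))

  agrees : ∀ x (x∈U : x ∈ U) (x∈W : x ∈ W) →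
           proj₁ (Func.to F′ (x , x∈W)) ≋ proj₁ (Func.to F (x , x∈U))
  agrees x x∈U x∈W i =
    -- The point `x` itself serves as the base point for gluing, so it is never necessary to decide
    -- whether `U` is empty.
    trans (extend-corners boolean-Φ boolean-s (Φ-injective x x∈U) (s≈⊤ x x∈U) i)
          (sym (F≋Φ (x , x∈U) i))
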